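{- For every sequent $\Gamma\Rightarrow\Delta$: if $\mathsf{Grz_{Seq}}+\mathsf{cut}\vdash\Gamma\Rightarrow\Delta$, then $\Gamma\Rightarrow\Delta$ is provable in $\mathsf{Grz}_\infty+\mathsf{cut}$.
   Context: Formulas are built from $\bot$ and atomic propositions using $\to$ and $\Box$. A sequent is $\Gamma\Rightarrow\Delta$ with $\Gamma,\Delta$ finite multisets of formulas; $\Box\Pi$ denotes the multiset $\{\Box B:B\in\Pi\}$. Common rules: $(\to_L)$ from $\Gamma,B\Rightarrow\Delta$ and $\Gamma\Rightarrow A,\Delta$ infer $\Gamma,A\to B\Rightarrow\Delta$; $(\to_R)$ from $\Gamma,A\Rightarrow B,\Delta$ infer $\Gamma\Rightarrow A\to B,\Delta$; $(\mathsf{refl})$ from $\Gamma,B,\Box B\Rightarrow\Delta$ infer $\Gamma,\Box B\Rightarrow\Delta$; $(\mathsf{cut})$ from $\Gamma\Rightarrow A,\Delta$ and $\Gamma,A\Rightarrow\Delta$ infer $\Gamma\Rightarrow\Delta$. The finite-proof calculus $\mathsf{Grz_{Seq}}+\mathsf{cut}$ has initial sequents $\Gamma,A\Rightarrow A,\Delta$ (any $A$) and $\Gamma,\bot\Rightarrow\Delta$, the rules $(\to_L),(\to_R),(\mathsf{refl}),(\mathsf{cut})$ and $(\Box_{\mathsf{Grz}})$: from $\Box\Pi,\Box(A\to\Box A)\Rightarrow A$ infer $\Gamma,\Box\Pi\Rightarrow\Box A,\Delta$. The calculus $\mathsf{Grz}_\infty+\mathsf{cut}$ has initial sequents $\Gamma,p\Rightarrow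 p,\Delta$ ($p$ atomic) and $\Gamma,\bot\Rightarrow\Delta$, the rules $(\to_L),(\to_R),(\mathsf{refl}),(\mathsf{cut})$ and $(\Box)$: from left premise $\Gamma,\Box\Pi\Rightarrow A,\Delta$ and right premise $\Box\Pi\Rightarrow A$ infer $\Gamma,\Box\Pi\Rightarrow\Box A,\Delta$. Proofs in $\mathsf{Grz}_\infty+\mathsf{cut}$ are $\infty$-proofs: possibly infinite trees of sequents built by these rules, with leaves labelled by initial sequents, in which every infinite branch passes through a right premise of $(\Box)$ infinitely often; a sequent is provable if it labels the root of an $\infty$-proof. -}

module Defs where

open import Data.List using (List; []; _∷_; _++_; map; head; drop; _∷ʳ_; applyUpTo)
open import Data.List.Relation.Binary.Permutation.Propositional using (_↭_)
open import Data.List.Relation.Unary.All using (All)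
open import Data.Maybe using (Maybe; just; nothing; Is-just; _>>=_)
open import Data.Maybe.Relation.Binary.Pointwise using (Pointwise)
open import Data.Nat using (ℕ; _≤_)
open import Data.Product using (_×_; Σ-syntax; ∃-syntax)
open import Relation.Binary.PropositionalEquality using (_≡_)

infixr 30 _⊃_
infix  35 □_
infix   4 _⇒_
infix   3 _≈_
infix   2 GrzSeq+cut⊢_ Grz∞+cut⊢_

data Formula (Atom : Set) : Set where
  atom : Atom → Formula Atom
  ⊥′   : Formula Atom
  _⊃_  : Formula Atom → Formula Atom → Formula Atom
  □_   : Formula Atom → Formula Atom

-- Finite multisets are lists, identified up to permutation by _≈_ below.
-- The rules are stated on representatives (with the principal formulas in
-- front); derivations close them under _≈_.
record Sequent (Atom : Set) : Set where
  constructor _⇒_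
  field
    antecedent : List (Formula Atom)
    succedent  : List (Formula Atom)

open Sequent public

variable
  Atom  : Set
  Γ Δ Π : List (Formula Atom)
  A B   : Formula Atom
  S C   : Sequent Atom
  Ps    : List (Sequent Atom)

_≈_ : Sequent Atom → Sequent Atom → Set
S ≈ S′ = (antecedent S ↭ antecedent S′) × (succedent S ↭ succedent S′)

□⋆ : List (Formula Atom) → List (Formula Atom)
□⋆ = map □_

-- A rule instance with premises Ps and conclusion C; the premises are listed
-- from left to right, and initial sequents are the instances without premises.
data CommonRule {Atom : Set} : List (Sequent Atom) → Sequent Atom → Set where
  ⊥-init : CommonRule [] (⊥′ ∷ Γ ⇒ Δ)
  ⊃L     : CommonRule ((B ∷ Γ ⇒ Δ) ∷ (Γ ⇒ A ∷ Δ) ∷ []) (A ⊃ B ∷ Γ ⇒ Δ)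
  ⊃R     : CommonRule ((A ∷ Γ ⇒ B ∷ Δ) ∷ []) (Γ ⇒ A ⊃ B ∷ Δ)
  refl   : CommonRule ((B ∷ □ B ∷ Γ ⇒ Δ) ∷ []) (□ B ∷ Γ ⇒ Δ)
  cut    : CommonRule ((Γ ⇒ A ∷ Δ) ∷ (A ∷ Γ ⇒ Δ) ∷ []) (Γ ⇒ Δ)

data GrzSeqRule {Atom : Set} : List (Sequent Atom) → Sequent Atom → Set where
  common : CommonRule Ps C → GrzSeqRule Ps C
  init   : GrzSeqRule [] (A ∷ Γ ⇒ A ∷ Δ)
  □Grz   : GrzSeqRule ((□ (A ⊃ □ A) ∷ □⋆ Π ⇒ A ∷ []) ∷ [])
                      (□⋆ Π ++ Γ ⇒ □ A ∷ Δ)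

data GrzSeq+cut⊢_ {Atom : Set} : Sequent Atom → Set where
  infer : GrzSeqRule Ps C → C ≈ S → All GrzSeq+cut⊢_ Ps → GrzSeq+cut⊢ S

data Grz∞Rule {Atom : Set} : List (Sequent Atom) → Sequent Atom → Set where
  common : CommonRule Ps C → Grz∞Rule Ps C
  init   : {p : Atom} → Grz∞Rule [] (atom p ∷ Γ ⇒ atom p ∷ Δ)
  box    : Grz∞Rule ((□⋆ Π ++ Γ ⇒ A ∷ Δ) ∷ (□⋆ Π ⇒ A ∷ []) ∷ [])
                    (□⋆ Π ++ Γ ⇒ □ A ∷ Δ)

record Inference (Atom : Set) : Set where
  constructor inference
  field
    {premises}   : List (Sequent Atom)
    {conclusion} : Sequent Atom
    rule         : Grz∞Rule premises conclusion

open Inference public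

-- The i-th premise, counted from 0; nothing when there is no such premise.
premise : Inference Atom → ℕ → Maybe (Sequent Atom)
premise r i = head (drop i (premises r))

-- A node is addressed by the list of child indices leading to it from the root.
Position : Set
Position = List ℕ

-- A possibly infinite tree with root S, as a partial function on positions: an
-- address that is not a node of the tree is sent to nothing, and a node is sent
-- to the rule instance applied there, the sequent labelling it being the
-- conclusion of that instance.  By `children`, the nodes just above a node are
-- exactly its premises (hence leaves are initial sequents), and there are no
-- nodes above an address that is not a node.
record Tree {Atom : Set} (S : Sequent Atom) : Set where
  _labels_ : Sequent Atom → Inference Atom → Set
  S′ labels r = S′ ≈ conclusion r

  field
    node     : Position → Maybe (Inference Atom)
    root     : Pointwise _labels_ (just S) (node [])
    children : ∀ p i →
               Pointwise _labels_ (node p >>= λ r → premise r i) (node (p ∷ʳ i))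

open Tree public using (node)

-- The step from the n-th to the (n+1)-st node of a branch β leads to its
-- β n-th child.
IsInfiniteBranch : Tree S → (ℕ → ℕ) → Set
IsInfiniteBranch t β = ∀ n → Is-just (node t (applyUpTo β n))

data IsBox {Atom : Set} : Inference Atom → Set where
  isBox : IsBox (inference (box {Π = Π} {Γ = Γ} {A = A} {Δ = Δ}))

RightPremiseAt : {S : Sequent Atom} → Tree S → (ℕ → ℕ) → ℕ → Set
RightPremiseAt t β n =
  ∃[ r ] (node t (applyUpTo β n) ≡ just r × IsBox r × β n ≡ 1)

Is∞Proof : Tree S → Set
Is∞Proof t = ∀ β → IsInfiniteBranch t β →
             ∀ n → ∃[ m ] (n ≤ m × RightPremiseAt t β m)

Grz∞+cut⊢_ : Sequent Atom → Set
Grz∞+cut⊢ S = Σ[ t ∈ Tree S ] Is∞Proof t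

{-# OPTIONS --safe #-}
-- The key observation is that the premise □(A ⊃ □A), □Π ⇒ A of the rule □Grz
-- already yields □Π ⇒ A in GrzSeq + cut, by a cut on □(A ⊃ □A).  Hence an
-- application of □Grz can be simulated by a finite tree of Grz∞ rules in which
-- some right premises of the box rule are left open, all of them derivable in
-- GrzSeq + cut.  Unfolding these open premises again and again gives the
-- ∞-proof: between two unfoldings a branch can only climb through a finite
-- tree.
module Submission where

open import Data.List using (List; []; _∷_; _++_; map; head; drop; _∷ʳ_; applyUpTo)
open import Data.List.Properties using (++-identityʳ)
open import Data.List.Relation.Binary.Permutation.Propositional
  using (↭-refl; ↭-sym; ↭-trans; ↭-reflexive; swap)
open import Data.List.Relation.Binary.Permutation.Propositional.Properties
  using (++⁺ʳ; ++-assoc; ++-comm)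
open import Data.List.Relation.Unary.All using (All; []; _∷_)
open import Data.Maybe using (Maybe; just; nothing; Is-just; _>>=_)
open import Data.Maybe.Relation.Binary.Pointwise using (Pointwise; just; nothing)
open import Data.Nat using (ℕ; zero; suc; _≤_; z≤n; s≤s)
open import Data.Nat.Properties using (m≤n⇒m≤1+n)
open import Data.Product using (_×_; _,_; ∃-syntax)
open import Data.Sum using (_⊎_; inj₁; inj₂)
open import Function using (_∘_)
open import Relation.Binary.PropositionalEquality using (_≡_; refl; sym)
open import Defs

≈-refl : S ≈ S
≈-refl = ↭-refl , ↭-refl

≈-sym : S ≈ C → C ≈ S
≈-sym (p , q) = ↭-sym p , ↭-sym q

≈-trans : {S T U : Sequent Atom} → S ≈ T → T ≈ U → S ≈ U
≈-trans (p , q) (p′ , q′) = ↭-trans p p′ , ↭-trans q q′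

-- Finite trees in which right premises of the box rule may be left open, given
-- as elements of X.
data Open {Atom : Set} (X : Sequent Atom → Set) : Sequent Atom → Set where
  infer  : S ≈ C → Grz∞Rule Ps C → All (Open X) Ps → Open X S
  unfold : S ≈ (□⋆ Π ++ Γ ⇒ □ A ∷ Δ) →
           Open X (□⋆ Π ++ Γ ⇒ A ∷ Δ) → X (□⋆ Π ⇒ A ∷ []) → Open X S

Open-resp-≈ : {X : Sequent Atom → Set} → S ≈ C → Open X C → Open X S
Open-resp-≈ e (infer e′ r ds) = infer (≈-trans e e′) r ds
Open-resp-≈ e (unfold e′ d x) = unfold (≈-trans e e′) d x

module Unfolding {Atom : Set} {X : Sequent Atom → Set}
                 (coalg : ∀ {S} → X S → Open X S) where

  lastInference : {S : Sequent Atom} → Open X S → Inference Atom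
  lastInference (infer _ r _) = inference r
  lastInference (unfold {Π = Π} {Γ = Γ} {A = A} {Δ = Δ} _ _ _) =
    inference (box {Π = Π} {Γ = Γ} {A = A} {Δ = Δ})

  -- The recursion is on the address: each step up the tree consumes one index, so it terminates
  -- even though `coalg x` is not a subtree of `d`.
  nodeAt    : {S : Sequent Atom} → Open X S → Position → Maybe (Inference Atom)
  nodeAtAll : {Ps : List (Sequent Atom)} →
              All (Open X) Ps → ℕ → Position → Maybe (Inference Atom)

  nodeAt d              []                = just (lastInference d)
  nodeAt (infer _ _ ds) (i ∷ p)           = nodeAtAll ds i p
  nodeAt (unfold _ d _) (0 ∷ p)           = nodeAt d p
  nodeAt (unfold _ _ x) (1 ∷ p)           = nodeAt (coalg x) p
  nodeAt (unfold _ _ _) (suc (suc _) ∷ _) = nothing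

  nodeAtAll []       _       _ = nothing
  nodeAtAll (d ∷ _)  zero    p = nodeAt d p
  nodeAtAll (_ ∷ ds) (suc i) p = nodeAtAll ds i p

  _Labels_ : Sequent Atom → Inference Atom → Set
  S Labels r = S ≈ conclusion r

  root-labels : {S : Sequent Atom} (d : Open X S) → S Labels lastInference d
  root-labels (infer e _ _)  = e
  root-labels (unfold e _ _) = e

  no-premise : ∀ i → Pointwise _Labels_ (head (drop i [])) nothing
  no-premise zero    = nothing
  no-premise (suc _) = nothing

  premises-label : {Ps : List (Sequent Atom)} (ds : All (Open X) Ps) → ∀ i →
                   Pointwise _Labels_ (head (drop i Ps)) (nodeAtAll ds i [])
  premises-label []       i       = no-premise i
  premises-label (d ∷ _)  zero    = just (root-labels d)
  premises-label (_ ∷ ds) (suc i) = premises-label ds i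

  children-label    : {S : Sequent Atom} (d : Open X S) → ∀ p i →
    Pointwise _Labels_ (nodeAt d p >>= λ r → premise r i) (nodeAt d (p ∷ʳ i))
  children-labelAll : {Ps : List (Sequent Atom)} (ds : All (Open X) Ps) → ∀ j p i →
    Pointwise _Labels_ (nodeAtAll ds j p >>= λ r → premise r i)
                       (nodeAtAll ds j (p ∷ʳ i))

  children-label (infer _ _ ds) []                i             = premises-label ds i
  children-label (unfold _ d _) []                0             = just (root-labels d)
  children-label (unfold _ _ x) []                1             = just (root-labels (coalg x))
  children-label (unfold _ _ _) []                (suc (suc i)) = no-premise i
  children-label (infer _ _ ds) (j ∷ p)           i             = children-labelAll ds j p i
  children-label (unfold _ d _) (0 ∷ p)           i             = children-label d p i
  children-label (unfold _ _ x) (1 ∷ p)           i             = children-label (coalg x) p i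
  children-label (unfold _ _ _) (suc (suc _) ∷ _) i             = nothing

  children-labelAll []       _       _ _ = nothing
  children-labelAll (d ∷ _)  zero    p i = children-label d p i
  children-labelAll (_ ∷ ds) (suc j) p i = children-labelAll ds j p i

  tree : {S : Sequent Atom} → Open X S → Tree S
  tree d = record
    { node     = nodeAt d
    ; root     = just (root-labels d)
    ; children = children-label d
    }

  Infinite : (Position → Maybe (Inference Atom)) → (ℕ → ℕ) → Set
  Infinite f β = ∀ n → Is-just (f (applyUpTo β n))

  RightPremiseFrom : ℕ → (Position → Maybe (Inference Atom)) → (ℕ → ℕ) → Set
  RightPremiseFrom n f β = ∃[ m ] (n ≤ m ×
    ∃[ r ] (f (applyUpTo β m) ≡ just r × IsBox r × β m ≡ 1))

  -- Recursion on n, which drops at every unfolding, and then on the finite tree.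
  rightPremise       : ∀ n {S : Sequent Atom} (d : Open X S) β →
    Infinite (nodeAt d) β → RightPremiseFrom n (nodeAt d) β
  rightPremiseAll    : ∀ n {Ps : List (Sequent Atom)} (ds : All (Open X) Ps) i β →
    Infinite (nodeAtAll ds i) β → RightPremiseFrom n (nodeAtAll ds i) β
  -- The index `i` stands for the first step of the whole branch, so that it can be matched on. That
  -- step counts too, hence the bound `n ≤ suc m`; in the left alternative it is itself the step
  -- sought.
  rightPremiseUnfold : ∀ n {S : Sequent Atom} {Π Γ Δ A}
    (e : S ≈ (□⋆ Π ++ Γ ⇒ □ A ∷ Δ)) (d : Open X (□⋆ Π ++ Γ ⇒ A ∷ Δ))
    (x : X (□⋆ Π ⇒ A ∷ [])) i β →
    let f = λ p → nodeAt (unfold {Π = Π} {Γ = Γ} {A = A} {Δ = Δ} e d x) (i ∷ p) in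
    Infinite f β →
    (n ≡ 0 × i ≡ 1) ⊎ (∃[ m ] (n ≤ suc m ×
      ∃[ r ] (f (applyUpTo β m) ≡ just r × IsBox r × β m ≡ 1)))

  rightPremise n (infer _ _ ds) β inf
    with m , n≤m , right ← rightPremiseAll n ds (β 0) (β ∘ suc) (inf ∘ suc)
    = suc m , m≤n⇒m≤1+n n≤m , right
  rightPremise n (unfold {Π = Π} {Γ = Γ} {A = A} {Δ = Δ} e d x) β inf
    with rightPremiseUnfold n {Π = Π} {Γ} {Δ} {A} e d x (β 0) (β ∘ suc) (inf ∘ suc)
  ... | inj₁ (refl , β0≡1) = 0 , z≤n , _ , refl , isBox {Π = Π} {Γ = Γ} , β0≡1
  ... | inj₂ (m , n≤1+m , right) = suc m , n≤1+m , right

  rightPremiseAll n []       _       β inf with () ← inf 0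
  rightPremiseAll n (d ∷ _)  zero    β inf = rightPremise n d β inf
  rightPremiseAll n (_ ∷ ds) (suc i) β inf = rightPremiseAll n ds i β inf

  rightPremiseUnfold n e d x 0 β inf
    with m , n≤m , right ← rightPremise n d β inf
    = inj₂ (m , m≤n⇒m≤1+n n≤m , right)
  rightPremiseUnfold zero e d x 1 β inf = inj₁ (refl , refl)
  -- Entering `coalg x` uses up one step of the branch, so the smaller bound `n` suffices beyond it.
  rightPremiseUnfold (suc n) e d x 1 β inf
    with m , n≤m , right ← rightPremise n (coalg x) β inf
    = inj₂ (m , s≤s n≤m , right)
  rightPremiseUnfold n e d x (suc (suc _)) β inf with () ← inf 0

  ∞-provable : {S : Sequent Atom} → Open X S → Grz∞+cut⊢ S
  ∞-provable d = tree d , λ β inf n → rightPremise n d β inf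

-- Initial sequents of the target calculus are atomic, so the general ones are built by induction on
-- `A`. Nothing is left open, whence `X` is arbitrary.
identity : {X : Sequent Atom → Set} (A : Formula Atom) → Open X (A ∷ Γ ⇒ A ∷ Δ)
identity (atom p) = infer ≈-refl init []
identity ⊥′       = infer ≈-refl (common ⊥-init) []
identity (A ⊃ B)  =
  infer ≈-refl (common ⊃R)
    (infer (swap _ _ ↭-refl , ↭-refl) (common ⊃L) (identity B ∷ identity A ∷ []) ∷ [])
identity (□ A)    =
  -- Putting `A` into `Π` keeps `□ A` in both premises, where `refl` unboxes it.
  infer ≈-refl (box {Π = A ∷ []}) (identity-refl ∷ identity-refl ∷ [])
  where
  identity-refl : Open _ (□ A ∷ Γ ⇒ A ∷ Δ)
  identity-refl = infer ≈-refl (common refl) (identity A ∷ [])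

weaken : List (Formula Atom) → List (Formula Atom) → Sequent Atom → Sequent Atom
weaken Γ Δ S = antecedent S ++ Γ ⇒ succedent S ++ Δ

weaken-≈ : ∀ Γ Δ → S ≈ C → weaken Γ Δ S ≈ weaken Γ Δ C
weaken-≈ Γ Δ (p , q) = ++⁺ʳ Γ p , ++⁺ʳ Δ q

-- Contexts are appended behind the principal formulas, so a weakened instance is an instance of the
-- same rule by computation.
weaken-common : ∀ Γ Δ → CommonRule Ps C →
                CommonRule (map (weaken Γ Δ) Ps) (weaken Γ Δ C)
weaken-common Γ Δ ⊥-init = ⊥-init
weaken-common Γ Δ ⊃L     = ⊃L
weaken-common Γ Δ ⊃R     = ⊃R
weaken-common Γ Δ refl   = refl
weaken-common Γ Δ cut    = cut

module _ (d : GrzSeq+cut⊢ (□ (A ⊃ □ A) ∷ □⋆ Π ⇒ A ∷ [])) where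

  -- `Γ` makes room for the diagonal formula that a further `□Grz`, applied to `A ⊃ □ A`, adds to
  -- its premise.
  □Grz-step : ∀ Γ → GrzSeq+cut⊢ (Γ ++ □⋆ Π ⇒ A ⊃ □ A ∷ [])
  □Grz-step Γ =
    infer (common ⊃R) ≈-refl
      (infer (□Grz {Π = Π} {Γ = A ∷ Γ}) (++-comm (□⋆ Π) (A ∷ Γ) , ↭-refl) (d ∷ []) ∷ [])

  □Grz-unboxed : GrzSeq+cut⊢ (□⋆ Π ⇒ A ∷ [])
  □Grz-unboxed =
    infer (common cut) ≈-refl
      ( infer (□Grz {Π = Π} {Γ = []}) (↭-reflexive (++-identityʳ (□⋆ Π)) , ↭-refl)
          (□Grz-step (_ ∷ []) ∷ [])
      ∷ d ∷ [])

-- The weakening keeps the recursion structural: premises of □Grz are needed in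
-- a larger context than the one in which they are derived.
unravel    : ∀ Γ Δ → GrzSeq+cut⊢ S → Open GrzSeq+cut⊢_ (weaken Γ Δ S)
unravelAll : ∀ Γ Δ → All GrzSeq+cut⊢_ Ps → All (Open GrzSeq+cut⊢_) (map (weaken Γ Δ) Ps)

unravel Γ Δ (infer (common r) e ds) =
  infer (weaken-≈ Γ Δ (≈-sym e)) (common (weaken-common Γ Δ r)) (unravelAll Γ Δ ds)
unravel Γ Δ (infer (init {A = A}) e []) =
  Open-resp-≈ (weaken-≈ Γ Δ (≈-sym e)) (identity A)
unravel Γ Δ (infer (□Grz {A = A} {Π = Π} {Γ = Γ′} {Δ = Δ′}) e (d ∷ [])) =
  Open-resp-≈ (≈-trans (weaken-≈ Γ Δ (≈-sym e)) (++-assoc (□⋆ Π) Γ′ Γ , ↭-refl))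
    (unfold {Π = Π} {Γ = Γ′ ++ Γ} ≈-refl
      -- The cut formula `□ (A ⊃ □ A)` is introduced by a second box instance. Its left premise
      -- reduces to an identity on `A`, because the outer box instance has already put `A` into the
      -- succedent; its right premise stays open.
      (infer ≈-refl (common cut)
        ( unfold {Π = Π} {Γ = Γ′ ++ Γ} ≈-refl
            (infer ≈-refl (common ⊃R)
              (Open-resp-≈ (↭-refl , swap _ _ ↭-refl) (identity A) ∷ []))
            (□Grz-step {Π = Π} d [])
        ∷ unravel (Γ′ ++ Γ) (Δ′ ++ Δ) d
        ∷ []))
      (□Grz-unboxed {Π = Π} d))

unravelAll Γ Δ []       = []
unravelAll Γ Δ (d ∷ ds) = unravel Γ Δ d ∷ unravelAll Γ Δ ds

unravel₀ : GrzSeq+cut⊢ S → Open GrzSeq+cut⊢_ S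
unravel₀ d =
  Open-resp-≈ (↭-reflexive (sym (++-identityʳ _)) , ↭-reflexive (sym (++-identityʳ _)))
    (unravel [] [] d)

theorem3p4 : {Atom : Set} (Γ Δ : List (Formula Atom)) →
    GrzSeq+cut⊢ (Γ ⇒ Δ) → Grz∞+cut⊢ (Γ ⇒ Δ)
-- Open premises are again derivations, so `unravel₀` both unfolds them and supplies the initial
-- tree.
theorem3p4 Γ Δ d = Unfolding.∞-provable unravel₀ (unravel₀ d)
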